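{- Let $d\le n$ be integers, and let $\mathcal{F}$ be a uniform family of subsets of $[n]=\{1,\dots,n\}$ (i.e. there is an integer $k$ with $|F|=k$ for every $F\in\mathcal{F}$) such that $\operatorname{Vdim}(\mathcal{F}\,\Delta\,\mathcal{F})\le d$. Then \[ |\mathcal{F}|\le 2\binom{n}{\lfloor d/2\rfloor}. \]
   Context: For families $\mathcal{F},\mathcal{G}$ of subsets of $[n]$, $\mathcal{F}\,\Delta\,\mathcal{G}:=\{A\,\Delta\, B:\ A\in\mathcal{F},\ B\in\mathcal{G}\}$, where $A\,\Delta\,B$ is the symmetric difference of sets. A family $\mathcal{F}$ shatters $M\subseteq[n]$ if $\{F\cap M: F\in\mathcal{F}\}=2^M$ (all subsets of $M$). The VC-dimension $\operatorname{Vdim}(\mathcal{F})$ is the maximum size of a set shattered by $\mathcal{F}$. -}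

module Defs where

open import Data.Nat using (ℕ; _≤_)
open import Data.Bool using (_xor_)
open import Data.Vec using (zipWith)
open import Data.List using (List)
open import Data.List.Membership.Propositional using () renaming (_∈_ to _∈ₗ_)
open import Data.Fin.Subset using (Subset; _∩_; _⊆_; ∣_∣)
open import Data.Product using (∃; _×_)
open import Relation.Binary.PropositionalEquality using (_≡_)

-- A family of subsets of [n] is a duplicate-free list (see Statement) of Subset n.

_Δ_ : ∀ {n} → Subset n → Subset n → Subset n
A Δ B = zipWith _xor_ A B

_∈Δ[_,_] : ∀ {n} → Subset n → List (Subset n) → List (Subset n) → Set
X ∈Δ[ 𝓕 , 𝓖 ] = ∃ λ A → ∃ λ B → (A ∈ₗ 𝓕) × (B ∈ₗ 𝓖) × (X ≡ A Δ B)

ShattersΔ : ∀ {n} → List (Subset n) → List (Subset n) → Subset n → Set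
ShattersΔ 𝓕 𝓖 M = ∀ S → S ⊆ M → ∃ λ G → G ∈Δ[ 𝓕 , 𝓖 ] × (G ∩ M ≡ S)

VdimΔ≤ : ∀ {n} → List (Subset n) → List (Subset n) → ℕ → Set
VdimΔ≤ 𝓕 𝓖 d = ∀ M → ShattersΔ 𝓕 𝓖 M → ∣ M ∣ ≤ d

Uniform : ∀ {n} → List (Subset n) → Set
Uniform 𝓕 = ∃ λ k → ∀ F → F ∈ₗ 𝓕 → ∣ F ∣ ≡ k

-- Over 𝔽₂, a set M that 𝓕 Δ 𝓕 does not shatter lets the monomial x^M be lowered on 𝓕 Δ 𝓕, so the
-- indicator of ∅ agrees there with a polynomial P of degree ≤ d.  The matrix P(A Δ B), A, B ∈ 𝓕, is
-- the identity, while P(x + y) is a sum of products x^I y^J in which |I| ≤ d/2 or |J| ≤ d/2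
-- (Croot–Lev–Pach).  On a slice {|x| = k} the polynomials of degree ≤ s ≤ n/2 are spanned by
-- n C s functions, so the matrix has rank at most 2 (n C ⌊d/2⌋).
--
-- For the slice bound, track the slack u of a point x in {u + |∁ x| = ℓ} (u = 0 is a slice), and
-- reduce polynomials of degree ≤ s modulo the terms (u choose j) x^I with j ≥ 1 and j + |I| ≤ s,
-- which vanish at u = 0.  Splitting off one coordinate then gives Pascal's recursion.

module Submission where

open import Defs
open import Data.Nat using (ℕ; _≤_; _*_; _/_)
open import Data.Nat.Combinatorics using (_C_)
open import Data.List using (List; length)
open import Data.List.Relation.Unary.Unique.Propositional using (Unique)
open import Data.Fin.Subset using (Subset)

open import Data.Bool using (Bool; true; false; not; _∧_; _xor_)
open import Data.Bool.Properties
  using (∧-distribˡ-xor; ∧-distribʳ-xor; ∧-zeroʳ; ∧-identityʳ; ∧-assoc; ∧-comm; xor-same; xor-identityʳ; ¬-not)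
  renaming (_≟_ to _≟ᵇ_)
open import Data.Bool.Solver using (module xor-∧-Solver)
open import Data.Empty using (⊥-elim)
open import Data.Fin using (Fin; zero; suc; combine)
open import Data.Fin.Properties using (combine-injective; combine-surjective; injective⇒≤)
  renaming (suc-injective to Fin-suc-injective)
open import Data.Fin.Subset using (⊤; ∁; ∣_∣; _∩_)
open import Data.Fin.Subset.Properties using (∣∁p∣≡n∸∣p∣; ∣p∣≤n; anySubset?; p∩q⊆p; x∈p∩q⁺; ⊆-antisym)
import Data.List as List
open import Data.List.Membership.Propositional using (_∈_; find; lose)
open import Data.List.Membership.Propositional.Properties using (∈-lookup)
import Data.List.Relation.Unary.All as All
open import Data.List.Relation.Unary.AllPairs using (_∷_)
open import Data.List.Relation.Unary.Any using (Any; any?)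
open import Data.Nat using (zero; suc; _+_; _∸_; _^_; _%_; _<_; z≤n; s≤s; z<s; _≤?_)
open import Data.Nat.Combinatorics using (nCk+nC[k+1]≡[n+1]C[k+1]; nCk≡nC[n∸k])
open import Data.Nat.DivMod using (m≡m%n+[m/n]*n; m%n<n; m/n*n≤m)
open import Data.Nat.Properties
  using (≤-refl; ≤-trans; ≤-reflexive; ≤-antisym; ≤-pred; ≰⇒>; <⇒≱; n≤1+n; m≤n⇒m≤1+n; m≤m+n; m≤n+m; 1+n≢0;
    suc-injective; +-suc; +-comm; +-assoc; +-identityʳ; +-monoʳ-<; +-monoˡ-≤; +-cancelˡ-<; *-comm; ^-monoʳ-<;
    m+n∸n≡m; m∸n+n≡m; module ≤-Reasoning)
open import Data.Product using (Σ; ∃; _×_; _,_; proj₁; proj₂)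
open import Data.Vec using (Vec; []; _∷_; _++_; head; tail; map; replicate; zipWith; lookup)
open import Data.Vec.Properties using (≡-dec; tabulate∘lookup; tabulate-cong)
open import Function using (_∘_)
open import Relation.Binary.PropositionalEquality
  using (_≡_; _≢_; refl; sym; trans; cong; cong₂; subst; module ≡-Reasoning)
open import Relation.Nullary using (¬_; Dec; yes; no; ¬?)
open import Relation.Nullary.Decidable using (decidable-stable)
open xor-∧-Solver using (solve; con; _:+_; _:*_; _:=_)

private variable
  X Y : Set
  n m s t r : ℕ

interchange : ∀ a b c d → (a xor b) xor (c xor d) ≡ (a xor c) xor (b xor d)
interchange = solve 4 (λ a b c d → (a :+ b) :+ (c :+ d) := (a :+ c) :+ (b :+ d)) refl

not-∧ : ∀ b c → not b ∧ c ≡ c xor (b ∧ c)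
not-∧ false c = sym (xor-identityʳ c)
not-∧ true  c = sym (xor-same c)

-- Linear spans of functions with values in 𝔽₂

BoolFun : Set → Set
BoolFun X = X → Bool

-- Over 𝔽₂ sums alone give all linear combinations. The constructor `ext` makes membership depend on
-- the values only.
data Span (G : BoolFun X → Set) : BoolFun X → Set where
  gen : ∀ {f} → G f → Span G f
  0#  : Span G (λ _ → false)
  _⊕_ : ∀ {f g} → Span G f → Span G g → Span G (λ x → f x xor g x)
  ext : ∀ {f g} → Span G f → (∀ x → f x ≡ g x) → Span G g

infixl 6 _⊕_

span-fold : ∀ {G : BoolFun X → Set} (P : BoolFun X → Set) →
  P (λ _ → false) →
  (∀ {f g} → P f → P g → P (λ x → f x xor g x)) →
  (∀ {f g} → P f → (∀ x → f x ≡ g x) → P g) →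
  (∀ {f} → G f → P f) → ∀ {f} → Span G f → P f
span-fold P z a e g (gen p)   = g p
span-fold P z a e g 0#        = z
span-fold P z a e g (p ⊕ q)   = a (span-fold P z a e g p) (span-fold P z a e g q)
span-fold P z a e g (ext p h) = e (span-fold P z a e g p) h

-- Substituting along `π` and multiplying by `w` is linear, so generators suffice. With `w` a
-- coordinate or a binomial, this is how degrees are raised below.
span-weighted-pullback : ∀ {G : BoolFun X → Set} {H : BoolFun Y → Set}
  (w : BoolFun Y) (π : Y → X) →
  (∀ {f} → G f → Span H (λ y → w y ∧ f (π y))) →
  ∀ {f} → Span G f → Span H (λ y → w y ∧ f (π y))
span-weighted-pullback {H = H} w π = span-fold (λ f → Span H (λ y → w y ∧ f (π y)))
  (ext 0# λ y → sym (∧-zeroʳ (w y)))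
  (λ p q → ext (p ⊕ q) λ y → sym (∧-distribˡ-xor (w y) _ _))
  (λ p e → ext p λ y → cong (w y ∧_) (e (π y)))

span-pullback : ∀ {G : BoolFun X → Set} {H : BoolFun Y → Set} (π : Y → X) →
  (∀ {f} → G f → Span H (f ∘ π)) → ∀ {f} → Span G f → Span H (f ∘ π)
span-pullback = span-weighted-pullback (λ _ → true)

span-mono : ∀ {G H : BoolFun X → Set} → (∀ {f} → G f → H f) → ∀ {f} → Span G f → Span H f
span-mono h = span-pullback (λ x → x) (gen ∘ h)

scale : ∀ {G : BoolFun X → Set} c {f} → Span G f → Span G (λ x → c ∧ f x)
scale false p = 0#
scale true  p = p

-- Multilinear polynomials over 𝔽₂ and their degree

monomial : Subset n → Subset n → Bool
monomial []          x = true
monomial (false ∷ I) x = monomial I (tail x)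
monomial (true ∷ I)  x = head x ∧ monomial I (tail x)

-- With a strict bound, `t = 0` gives the zero space, so "lower-order terms" makes sense even for
-- the constant monomial.
data Monomial< (t : ℕ) : BoolFun (Subset n) → Set where
  mono : (I : Subset n) → ∣ I ∣ < t → Monomial< t (monomial I)

Poly< : ℕ → BoolFun (Subset n) → Set
Poly< t = Span (Monomial< t)

poly-weaken : ∀ {s t} {f : BoolFun (Subset n)} → s ≤ t → Poly< s f → Poly< t f
poly-weaken s≤t = span-mono λ { (mono I p) → mono I (≤-trans p s≤t) }

poly-tail : ∀ {t} {f : BoolFun (Subset n)} → Poly< t f → Poly< t (f ∘ tail)
poly-tail = span-pullback tail λ { (mono I p) → gen (mono (false ∷ I) p) }

poly-head∧ : ∀ {t} {f : BoolFun (Subset n)} →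
  Poly< t f → Poly< (suc t) (λ x → head x ∧ f (tail x))
poly-head∧ = span-weighted-pullback head tail λ { (mono I p) → gen (mono (true ∷ I) (s≤s p)) }

poly-¬head∧ : ∀ {t} {f : BoolFun (Subset n)} →
  Poly< t f → Poly< (suc t) (λ x → not (head x) ∧ f (tail x))
poly-¬head∧ p =
  ext (poly-weaken (n≤1+n _) (poly-tail p) ⊕ poly-head∧ p) λ x → sym (not-∧ (head x) _)

poly-true : Poly< {n} (suc t) (λ _ → true)
poly-true {zero}  = gen (mono [] z<s)
poly-true {suc n} = poly-tail (poly-true {n})

poly-∁ : ∀ {t} {f : BoolFun (Subset n)} → Poly< t f → Poly< t (f ∘ ∁)
poly-∁ = span-pullback ∁ λ { (mono I p) → poly-weaken p (monomial-∁ I) }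
  where
  monomial-∁ : ∀ {n} (I : Subset n) → Poly< (suc ∣ I ∣) (monomial I ∘ ∁)
  monomial-∁ []          = gen (mono [] z<s)
  monomial-∁ (false ∷ I) = ext (poly-tail (monomial-∁ I)) λ { (b ∷ x) → refl }
  monomial-∁ (true ∷ I)  = ext (poly-¬head∧ (monomial-∁ I)) λ { (b ∷ x) → refl }

-- Binomial coefficients modulo 2

binom₂ : ℕ → ℕ → Bool
binom₂ _       zero    = true
binom₂ zero    (suc j) = false
binom₂ (suc u) (suc j) = binom₂ u j xor binom₂ u (suc j)

-- Let b be a coordinate in `I` and y the count over the rest. Pascal's rule gives (b + y choose m +
-- 1) = b (y choose m) + (y choose m + 1): each new factor b is paid for by lowering `m`.
binom₂-poly : ∀ (I : Subset n) K m → Poly< (suc m) (λ x → binom₂ (∣ I ∩ x ∣ + K) m)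
binom₂-poly []          K m       = ext (scale (binom₂ K m) poly-true) λ { [] → ∧-identityʳ _ }
binom₂-poly (false ∷ I) K m       = ext (poly-tail (binom₂-poly I K m)) λ { (b ∷ x) → refl }
binom₂-poly (true ∷ I)  K zero    = poly-true
binom₂-poly (true ∷ I)  K (suc m) =
  ext (poly-head∧ (binom₂-poly I K m) ⊕ poly-tail (binom₂-poly I K (suc m)))
    λ { (false ∷ x) → refl ; (true ∷ x) → refl }

-- Only the coordinates in `I` occur, so their number bounds the degree whatever `m` is. Pascal's
-- rule is now charged to these coordinates.
binom₂-poly-size : ∀ (I : Subset n) K m → Poly< (suc ∣ I ∣) (λ x → binom₂ (∣ I ∩ x ∣ + K) m)
binom₂-poly-size []          K m       = ext (scale (binom₂ K m) poly-true) λ { [] → ∧-identityʳ _ }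
binom₂-poly-size (false ∷ I) K m       = ext (poly-tail (binom₂-poly-size I K m)) λ { (b ∷ x) → refl }
binom₂-poly-size (true ∷ I)  K zero    = poly-true
binom₂-poly-size (true ∷ I)  K (suc m) =
  ext (poly-head∧ (binom₂-poly-size I K m)
        ⊕ poly-tail (poly-weaken (n≤1+n _) (binom₂-poly-size I K (suc m))))
    λ { (false ∷ x) → refl ; (true ∷ x) → refl }

-- In Pascal's rule for a coordinate b of `I`, only the term with factor b can reach full degree;
-- the other one involves one coordinate fewer and is of lower order.
binom₂-leading : ∀ (I : Subset n) K →
  Poly< ∣ I ∣ (λ x → monomial I x xor binom₂ (∣ I ∩ x ∣ + K) ∣ I ∣)
binom₂-leading []          K = 0#
binom₂-leading (false ∷ I) K = ext (poly-tail (binom₂-leading I K)) λ { (b ∷ x) → refl }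
binom₂-leading (true ∷ I)  K =
  ext (poly-head∧ (binom₂-leading I K) ⊕ poly-tail (binom₂-poly-size I K (suc ∣ I ∣)))
    λ { (false ∷ x) → refl
      ; (true ∷ x) → solve 3 (λ a b c → (a :+ b) :+ c := a :+ (b :+ c)) refl (monomial I x) _ _ }

-- Σ_{j ≤ m} p (k + j) q (m - j)
convolution : (p q : ℕ → Bool) → ℕ → ℕ → Bool
convolution p q k zero    = p k ∧ q zero
convolution p q k (suc m) = (p k ∧ q (suc m)) xor convolution p q (suc k) m

convolution-binom₂-suc : ∀ u q k m →
  convolution (binom₂ (suc u)) q (suc k) m ≡
  convolution (binom₂ u) q k m xor convolution (binom₂ u) q (suc k) m
convolution-binom₂-suc u q k zero    =
  solve 3 (λ a b c → (a :+ b) :* c := a :* c :+ b :* c) refl (binom₂ u k) (binom₂ u (suc k)) (q zero)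
convolution-binom₂-suc u q k (suc m) rewrite convolution-binom₂-suc u q (suc k) m =
  solve 5 (λ a b c d e → (a :+ b) :* c :+ (d :+ e) := (a :* c :+ d) :+ (b :* c :+ e)) refl
    (binom₂ u k) (binom₂ u (suc k)) (q (suc m)) _ _

convolution-binom₂-zero : ∀ q k m → convolution (binom₂ zero) q (suc k) m ≡ false
convolution-binom₂-zero q k zero    = refl
convolution-binom₂-zero q k (suc m) = convolution-binom₂-zero q (suc k) m

-- Induction on `u`: Pascal's rule applies directly on the left, and through
-- `convolution-binom₂-suc` on the right.
vandermonde₂ : ∀ u w m → binom₂ (u + w) m ≡ convolution (binom₂ u) (binom₂ w) zero m
vandermonde₂ u       w zero    = refl
vandermonde₂ zero    w (suc m)
  rewrite convolution-binom₂-zero (binom₂ w) zero m = sym (xor-identityʳ _)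
vandermonde₂ (suc u) w (suc m)
  rewrite convolution-binom₂-suc u (binom₂ w) zero m
        | vandermonde₂ u w m | vandermonde₂ u w (suc m) =
  solve 3 (λ a b c → a :+ (b :+ c) := b :+ (a :+ c)) refl
    (convolution (binom₂ u) (binom₂ w) zero m) (binom₂ w (suc m))
    (convolution (binom₂ u) (binom₂ w) 1 m)

-- Slack terms and the reduction of monomials on large sets

data Slack< (t : ℕ) : BoolFun (ℕ × Subset n) → Set where
  slack : ∀ j (I : Subset n) → suc j + ∣ I ∣ < t →
    Slack< t (λ ux → binom₂ (proj₁ ux) (suc j) ∧ monomial I (proj₂ ux))

SlackSpan : ℕ → BoolFun (ℕ × Subset n) → Set
SlackSpan t = Span (Slack< t)

slackSpan-weaken : ∀ {s t} {q : BoolFun (ℕ × Subset n)} → s ≤ t → SlackSpan s q → SlackSpan t q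
slackSpan-weaken s≤t = span-mono λ { (slack j I p) → slack j I (≤-trans p s≤t) }

slackSpan-vanishes : ∀ {q : BoolFun (ℕ × Subset n)} → SlackSpan t q → ∀ x → q (zero , x) ≡ false
slackSpan-vanishes p x = span-fold (λ q → q (zero , x) ≡ false) refl (cong₂ _xor_)
  (λ e h → trans (sym (h _)) e) (λ { (slack j I _) → refl }) p

slackSpan-poly : ∀ {f : BoolFun (Subset n)} j → Poly< s f →
  SlackSpan (suc j + s) (λ ux → binom₂ (proj₁ ux) (suc j) ∧ f (proj₂ ux))
slackSpan-poly j = span-weighted-pullback (λ ux → binom₂ (proj₁ ux) (suc j)) proj₂
  λ { (mono I p) → gen (slack j I (+-monoʳ-< (suc j) p)) }

-- Along the convolution the weight of the slack factor rises exactly as the degree of `w` falls, so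
-- all summands obey one bound on the total.
slackSpan-convolution : ∀ (w : ℕ → BoolFun (Subset n)) → (∀ i → Poly< (suc i) (w i)) → ∀ k m →
  SlackSpan (suc k + suc m) (λ ux → convolution (binom₂ (proj₁ ux)) (λ i → w i (proj₂ ux)) (suc k) m)
slackSpan-convolution w d k zero    = slackSpan-poly k (d zero)
slackSpan-convolution w d k (suc m) = slackSpan-poly k (d (suc m)) ⊕
  slackSpan-weaken (≤-reflexive (sym (+-suc (suc k) (suc m)))) (slackSpan-convolution w d (suc k) m)

-- Both sides count the union of `I` and `∁ x`.
count-identity : ∀ (I x : Subset n) → ∣ I ∩ x ∣ + ∣ ∁ x ∣ ≡ ∣ ∁ I ∩ ∁ x ∣ + ∣ I ∣
count-identity []          []          = refl
count-identity (true ∷ I)  (true ∷ x)  = trans (cong suc (count-identity I x)) (sym (+-suc _ _))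
count-identity (true ∷ I)  (false ∷ x) =
  trans (+-suc _ _) (trans (cong suc (count-identity I x)) (sym (+-suc _ _)))
count-identity (false ∷ I) (true ∷ x)  = count-identity I x
count-identity (false ∷ I) (false ∷ x) = trans (+-suc _ _) (cong suc (count-identity I x))

-- On {u + |∁ x| = ℓ} we have |I ∩ x| + ℓ = u + |∁ I ∩ ∁ x| + |I|.  Apply (· choose |I|): the left side
-- has leading term x^I; on the right, Vandermonde leaves, modulo slack terms, a function of the
-- coordinates outside I only, of degree at most |∁ I| < |I|.
majority-reduction : ∀ (I : Subset n) ℓ → ∣ ∁ I ∣ < ∣ I ∣ →
  ∃ λ p → ∃ λ q → Poly< ∣ I ∣ p × SlackSpan (suc ∣ I ∣) q ×
    (∀ u x → u + ∣ ∁ x ∣ ≡ ℓ → monomial I x ≡ p x xor q (u , x))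
majority-reduction I ℓ lt = _ , _ ,
  binom₂-leading I ℓ ⊕ poly-weaken lt (poly-∁ (binom₂-poly-size (∁ I) ∣ I ∣ ∣ I ∣)) ,
  proj₁ (proj₂ (slackPart ∣ I ∣)) , identity
  where
  w : ℕ → BoolFun (Subset _)
  w i x = binom₂ (∣ ∁ I ∩ ∁ x ∣ + ∣ I ∣) i

  -- The summand of index 0 has slack factor 1 and gives `w m`; every later summand has a positive
  -- index and is a slack term.
  slackPart : ∀ m → ∃ λ q → SlackSpan (suc m) q ×
    (∀ u x → convolution (binom₂ u) (λ i → w i x) zero m ≡ w m x xor q (u , x))
  slackPart zero    = _ , 0# , λ u x → refl
  slackPart (suc m) = _ , slackSpan-convolution w (λ i → poly-∁ (binom₂-poly (∁ I) ∣ I ∣ i)) zero m ,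
    λ u x → refl

  shift : ∀ u x → u + ∣ ∁ x ∣ ≡ ℓ → ∣ I ∩ x ∣ + ℓ ≡ u + (∣ ∁ I ∩ ∁ x ∣ + ∣ I ∣)
  shift u x refl = begin
    ∣ I ∩ x ∣ + (u + ∣ ∁ x ∣)       ≡⟨ sym (+-assoc ∣ I ∩ x ∣ u _) ⟩
    ∣ I ∩ x ∣ + u + ∣ ∁ x ∣         ≡⟨ cong (_+ ∣ ∁ x ∣) (+-comm ∣ I ∩ x ∣ u) ⟩
    u + ∣ I ∩ x ∣ + ∣ ∁ x ∣         ≡⟨ +-assoc u _ _ ⟩
    u + (∣ I ∩ x ∣ + ∣ ∁ x ∣)       ≡⟨ cong (u +_) (count-identity I x) ⟩
    u + (∣ ∁ I ∩ ∁ x ∣ + ∣ I ∣)     ∎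
    where open ≡-Reasoning

  cancel : ∀ a c d → a ≡ ((a xor (c xor d)) xor c) xor d
  cancel = solve 3 (λ a c d → a := ((a :+ (c :+ d)) :+ c) :+ d) refl

  identity : ∀ u x → u + ∣ ∁ x ∣ ≡ ℓ → monomial I x ≡ _
  identity u x e = trans (cancel (monomial I x) (w ∣ I ∣ x) (proj₁ (slackPart ∣ I ∣) (u , x)))
    (cong (λ b → ((monomial I x xor b) xor w ∣ I ∣ x) xor proj₁ (slackPart ∣ I ∣) (u , x))
      (sym (trans (cong (λ k → binom₂ k ∣ I ∣) (shift u x e))
        (trans (vandermonde₂ u _ ∣ I ∣) (proj₂ (proj₂ (slackPart ∣ I ∣)) u x)))))

-- Inner products over 𝔽₂

dot : Vec Bool r → Vec Bool r → Bool
dot []      []      = false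
dot (c ∷ v) (d ∷ w) = (c ∧ d) xor dot v w

dot-zeroˡ : ∀ (v : Vec Bool r) → dot (replicate r false) v ≡ false
dot-zeroˡ []      = refl
dot-zeroˡ (_ ∷ v) = dot-zeroˡ v

dot-comm : ∀ (v w : Vec Bool r) → dot v w ≡ dot w v
dot-comm []      []      = refl
dot-comm (c ∷ v) (d ∷ w) = cong₂ _xor_ (∧-comm c d) (dot-comm v w)

dot-xorˡ : ∀ (c d v : Vec Bool r) → dot (zipWith _xor_ c d) v ≡ dot c v xor dot d v
dot-xorˡ []      []      []      = refl
dot-xorˡ (a ∷ c) (b ∷ d) (e ∷ v) rewrite dot-xorˡ c d v =
  solve 5 (λ a b e x y → (a :+ b) :* e :+ (x :+ y) := (a :* e :+ x) :+ (b :* e :+ y)) refl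
    a b e (dot c v) (dot d v)

dot-∧ˡ : ∀ b (c v : Vec Bool r) → dot (map (b ∧_) c) v ≡ b ∧ dot c v
dot-∧ˡ b []      []      = sym (∧-zeroʳ b)
dot-∧ˡ b (a ∷ c) (e ∷ v) rewrite dot-∧ˡ b c v =
  solve 4 (λ b a e x → (b :* a) :* e :+ b :* x := b :* (a :* e :+ x)) refl b a e (dot c v)

dot-zeroʳ : ∀ (v : Vec Bool r) → dot v (replicate r false) ≡ false
dot-zeroʳ v = trans (dot-comm v _) (dot-zeroˡ v)

dot-xorʳ : ∀ (v c d : Vec Bool r) → dot v (zipWith _xor_ c d) ≡ dot v c xor dot v d
dot-xorʳ v c d = trans (dot-comm v _) (trans (dot-xorˡ c d v) (cong₂ _xor_ (dot-comm c v) (dot-comm d v)))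

dot-∧ʳ : ∀ b (v c : Vec Bool r) → dot v (map (b ∧_) c) ≡ b ∧ dot v c
dot-∧ʳ b v c = trans (dot-comm v _) (trans (dot-∧ˡ b c v) (cong (b ∧_) (dot-comm c v)))

dot-++ : ∀ (c v : Vec Bool r) (d w : Vec Bool s) → dot (c ++ d) (v ++ w) ≡ dot c v xor dot d w
dot-++ []      []      d w = refl
dot-++ (a ∷ c) (b ∷ v) d w rewrite dot-++ c v d w =
  solve 3 (λ x y z → x :+ (y :+ z) := (x :+ y) :+ z) refl (a ∧ b) (dot c v) (dot d w)

dot-++-zeroˡ : ∀ (c v : Vec Bool r) (w : Vec Bool s) →
  dot (replicate s false ++ c) (w ++ v) ≡ dot c v
dot-++-zeroˡ c v w =
  trans (dot-++ (replicate _ false) w c v) (cong (_xor dot c v) (dot-zeroˡ w))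

dot-++-zeroʳ : ∀ (c v : Vec Bool r) (w : Vec Bool s) →
  dot (c ++ replicate s false) (v ++ w) ≡ dot c v
dot-++-zeroʳ c v w = trans (dot-++ c v (replicate _ false) w)
  (trans (cong (dot c v xor_) (dot-zeroˡ w)) (xor-identityʳ _))

-- Spanning functions on a slice, modulo slack terms

Reducible : (Subset n → Vec Bool r) → ℕ → ℕ → BoolFun (ℕ × Subset n) → Set
Reducible a ℓ t F = ∃ λ c → ∃ λ q → SlackSpan t q ×
  (∀ u x → u + ∣ ∁ x ∣ ≡ ℓ → F (u , x) ≡ dot c (a x) xor q (u , x))

module _ {a : Subset n → Vec Bool r} {ℓ : ℕ} where

  reducible-zero : ∀ {F} → (∀ u x → u + ∣ ∁ x ∣ ≡ ℓ → F (u , x) ≡ false) → Reducible a ℓ t F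
  reducible-zero z = replicate _ false , _ , 0# , λ u x e →
    trans (z u x e) (sym (trans (xor-identityʳ _) (dot-zeroˡ (a x))))

  reducible-xor : ∀ {F G} → Reducible a ℓ t F → Reducible a ℓ t G →
    Reducible a ℓ t (λ z → F z xor G z)
  reducible-xor (c , q , p , e) (c′ , q′ , p′ , e′) = zipWith _xor_ c c′ , _ , p ⊕ p′ , λ u x d →
    trans (cong₂ _xor_ (e u x d) (e′ u x d))
      (trans (interchange (dot c (a x)) (q (u , x)) (dot c′ (a x)) (q′ (u , x)))
        (cong (_xor _) (sym (dot-xorˡ c c′ (a x)))))

  reducible-ext : ∀ {F G} → Reducible a ℓ t F →
    (∀ u x → u + ∣ ∁ x ∣ ≡ ℓ → F (u , x) ≡ G (u , x)) → Reducible a ℓ t G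
  reducible-ext (c , q , p , e) h = c , q , p , λ u x d → trans (sym (h u x d)) (e u x d)

  reducible-slack : ∀ {q} → SlackSpan t q → Reducible a ℓ t q
  reducible-slack {q = q} p = replicate _ false , q , p , λ u x _ →
    cong (_xor q (u , x)) (sym (dot-zeroˡ (a x)))

  reducible-weaken : ∀ {s t F} → s ≤ t → Reducible a ℓ s F → Reducible a ℓ t F
  reducible-weaken s≤t (c , q , p , e) = c , q , slackSpan-weaken s≤t p , e

  reducible-span : ∀ {G : BoolFun X → Set} (π : ℕ × Subset n → X) →
    (∀ {f} → G f → Reducible a ℓ t (f ∘ π)) → ∀ {f} → Span G f → Reducible a ℓ t (f ∘ π)
  reducible-span π = span-fold (λ f → Reducible a ℓ _ (f ∘ π))
    (reducible-zero λ _ _ _ → refl) reducible-xor (λ p h → reducible-ext p λ u x _ → h (π (u , x)))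

-- One `a` serves all levels `ℓ`, and only the coefficients depend on `ℓ`. The recursion needs this:
-- it invokes the smaller cases at two different levels.
Spanning : (n s r : ℕ) → Set
Spanning n s r = Σ (Subset n → Vec Bool r) λ a →
  ∀ ℓ {f} → Poly< (suc s) f → Reducible a ℓ (suc s) (f ∘ proj₂)

spanning-constants : ∀ n → Spanning n 0 1
spanning-constants n = (λ _ → true ∷ []) , λ ℓ → reducible-span proj₂ λ
  { (mono I p) → true ∷ [] , _ , 0# , λ u x _ → monomial-empty I p x }
  where
  monomial-empty : ∀ {n} (I : Subset n) → ∣ I ∣ < 1 → ∀ x → monomial I x ≡ true
  monomial-empty []          _         x = refl
  monomial-empty (false ∷ I) p         x = monomial-empty I p (tail x)
  monomial-empty (true ∷ I)  (s≤s ())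

-- In [2s + 1] every set of size s + 1 is larger than its complement, so nothing new is needed in degree s + 1.
spanning-middle : ∀ {n s r} → n ≡ suc (s + s) → Spanning n s r → Spanning n (suc s) r
spanning-middle {n} {s} n≡ (a , red) = a , λ ℓ → reducible-span proj₂ λ { (mono I p) → monomials ℓ I p }
  where
  monomials : ∀ ℓ I → ∣ I ∣ < suc (suc s) → Reducible a ℓ (suc (suc s)) (monomial I ∘ proj₂)
  monomials ℓ I p with ∣ I ∣ ≤? s
  ... | yes small = reducible-weaken (n≤1+n _) (red ℓ (gen (mono I (s≤s small))))
  ... | no  large = extend (majority-reduction I ℓ majority)
    where
    size : ∣ I ∣ ≡ suc s
    size = ≤-antisym (≤-pred p) (≰⇒> large)

    majority : ∣ ∁ I ∣ < ∣ I ∣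
    majority rewrite ∣∁p∣≡n∸∣p∣ I | size | n≡ | m+n∸n≡m s s = ≤-refl

    extend : _ → Reducible a ℓ (suc (suc s)) (monomial I ∘ proj₂)
    extend (f , q , pf , pq , e) = reducible-ext
      (reducible-xor (reducible-weaken (n≤1+n _) (red ℓ (poly-weaken (≤-reflexive size) pf)))
        (reducible-slack (slackSpan-weaken (≤-reflexive (cong suc size)) pq)))
      λ u x d → sym (e u x d)

module _ {n s r₀ r₁ : ℕ} where

  -- Let b be the head coordinate. Since b x^I = x^I + (1 - b) x^I, two kinds of terms suffice.
  -- Monomials in the tail are reduced by `a₀`, the value of b being recorded as slack. Multiples of
  -- 1 - b live on b = 0 and leave degree at most `s` for the tail, so `a₁` reduces them.
  spanning-step : Spanning n (suc s) r₀ → Spanning n s r₁ → Spanning (suc n) (suc s) (r₀ + r₁)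
  spanning-step (a₀ , red₀) (a₁ , red₁) = a , λ ℓ → reducible-span proj₂ λ { (mono I p) → monomials ℓ I p }
    where
    a : Subset (suc n) → Vec Bool (r₀ + r₁)
    a x = a₀ (tail x) ++ map (not (head x) ∧_) (a₁ (tail x))

    -- Dropping a coordinate with value 0 increases the slack, so that u + |∁ x| is preserved.
    drop : ℕ × Subset (suc n) → ℕ × Subset n
    drop (u , true ∷ x)  = u , x
    drop (u , false ∷ x) = suc u , x

    drop-level : ∀ {ℓ} u (x : Subset (suc n)) → u + ∣ ∁ x ∣ ≡ ℓ →
      proj₁ (drop (u , x)) + ∣ ∁ (proj₂ (drop (u , x))) ∣ ≡ ℓ
    drop-level u (true ∷ x)  e = e
    drop-level u (false ∷ x) e = trans (sym (+-suc u _)) e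

    ¬head∧ : BoolFun (ℕ × Subset n) → BoolFun (ℕ × Subset (suc n))
    ¬head∧ F (u , x) = not (head x) ∧ F (u , tail x)

    ¬head∧-slack : ∀ {t q} → SlackSpan t q → SlackSpan (suc t) (¬head∧ q)
    ¬head∧-slack = span-weighted-pullback (λ ux → not (head (proj₂ ux))) (λ ux → proj₁ ux , tail (proj₂ ux)) λ
      { (slack j I p) → ext
          (gen (slack j (false ∷ I) (m≤n⇒m≤1+n p))
            ⊕ gen (slack j (true ∷ I) (s≤s (≤-trans (≤-reflexive (+-suc (suc j) ∣ I ∣)) p))))
          λ { (u , b ∷ x) → expand b (binom₂ u (suc j)) (monomial I x) } }
      where
      expand : ∀ b c d → (c ∧ d) xor (c ∧ (b ∧ d)) ≡ not b ∧ (c ∧ d)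
      expand true  c d = xor-same (c ∧ d)
      expand false c d = trans (cong ((c ∧ d) xor_) (∧-zeroʳ c)) (xor-identityʳ _)

    -- Where the head is 0, the tail has the same slack and one point fewer in its complement, so
    -- the reduction one level down applies.
    ¬head∧-reducible : ∀ {t F} → (∀ ℓ → Reducible a₁ ℓ t F) → ∀ ℓ → Reducible a ℓ (suc t) (¬head∧ F)
    -- At level 0 the complement is empty, so the factor `not (head x)` is 0 throughout.
    ¬head∧-reducible red zero = reducible-zero λ
      { u (true ∷ x)  e → refl
      ; u (false ∷ x) e → ⊥-elim (1+n≢0 (trans (sym (+-suc u _)) e)) }
    ¬head∧-reducible {F = F} red (suc ℓ) with red ℓ
    ... | c , q , p , e = replicate _ false ++ c , _ , ¬head∧-slack p , λ u x d →
      trans (pointwise u x d) (cong (_xor _)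
        (sym (trans (dot-++-zeroˡ c _ (a₀ (tail x))) (dot-∧ʳ (not (head x)) c (a₁ (tail x))))))
      where
      pointwise : ∀ u x → u + ∣ ∁ x ∣ ≡ suc ℓ →
        ¬head∧ F (u , x) ≡ (not (head x) ∧ dot c (a₁ (tail x))) xor ¬head∧ q (u , x)
      pointwise u (true ∷ x)  d = refl
      pointwise u (false ∷ x) d = e u x (suc-injective (trans (sym (+-suc u _)) d))

    -- With b the head, (u + (1 - b) choose j + 1) = (u choose j + 1) + (1 - b) (u choose j). A unit
    -- of slack weight is exchanged for the factor 1 - b, which is why slack counts as degree. The
    -- second term stays slack unless j = 0; then it is (1 - b) x^I, and `red₁` takes over.
    drop-slack : ∀ ℓ {q} → SlackSpan (suc (suc s)) q → Reducible a ℓ (suc (suc s)) (q ∘ drop)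
    drop-slack ℓ = reducible-span drop λ { (slack j I p) → pascal j I p }
      where
      pascal : ∀ j I → suc j + ∣ I ∣ < suc (suc s) → Reducible a ℓ (suc (suc s))
        (λ ux → binom₂ (proj₁ (drop ux)) (suc j) ∧ monomial I (proj₂ (drop ux)))
      pascal j I p = reducible-ext
        (reducible-xor (reducible-slack (gen (slack j (false ∷ I) p))) (lower j p))
        λ { u (true ∷ x) _  → xor-identityʳ _
          ; u (false ∷ x) _ → solve 3 (λ a b c → a :* c :+ b :* c := (b :+ a) :* c) refl
                                (binom₂ u (suc j)) (binom₂ u j) (monomial I x) }
        where
        lower : ∀ j → suc j + ∣ I ∣ < suc (suc s) → Reducible a ℓ (suc (suc s))
          (¬head∧ (λ ux → binom₂ (proj₁ ux) j ∧ monomial I (proj₂ ux)))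
        lower zero    p = ¬head∧-reducible (λ ℓ → red₁ ℓ (gen (mono I (≤-pred p)))) ℓ
        lower (suc j) p = reducible-slack (¬head∧-slack (gen (slack j I (≤-pred p))))

    -- `drop` does not alter the tail, so the `a₀` part carries over as it is; only the slack part
    -- has to be reduced again.
    drop-reducible : ∀ ℓ {F} → Reducible a₀ ℓ (suc (suc s)) F → Reducible a ℓ (suc (suc s)) (F ∘ drop)
    drop-reducible ℓ (c , q , p , e) = reducible-ext
      (reducible-xor (c ++ replicate _ false , _ , 0# , λ u x _ → refl) (drop-slack ℓ p))
      λ u x d → trans
        (cong (_xor q (drop (u , x))) (trans (xor-identityʳ _)
          (trans (dot-++-zeroʳ c (a₀ (tail x)) _) (cong (dot c ∘ a₀) (drop-tail u x)))))
        (sym (e _ _ (drop-level u x d)))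
      where
      drop-tail : ∀ u (x : Subset (suc n)) → tail x ≡ proj₂ (drop (u , x))
      drop-tail u (true ∷ x)  = refl
      drop-tail u (false ∷ x) = refl

    tail-monomial : ∀ ℓ I → ∣ I ∣ < suc (suc s) → Reducible a ℓ (suc (suc s)) (monomial I ∘ tail ∘ proj₂)
    tail-monomial ℓ I p = reducible-ext (drop-reducible ℓ (red₀ ℓ (gen (mono I p))))
      λ { u (true ∷ x) _ → refl ; u (false ∷ x) _ → refl }

    monomials : ∀ ℓ I → ∣ I ∣ < suc (suc s) → Reducible a ℓ (suc (suc s)) (monomial I ∘ proj₂)
    monomials ℓ (false ∷ I) p = tail-monomial ℓ I p
    monomials ℓ (true ∷ I)  p = reducible-ext
      (reducible-xor (tail-monomial ℓ I (m≤n⇒m≤1+n (≤-pred p)))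
        (¬head∧-reducible (λ ℓ → red₁ ℓ (gen (mono I (≤-pred p)))) ℓ))
      λ { u (true ∷ x) _ → xor-identityʳ _ ; u (false ∷ x) _ → xor-same (monomial I x) }

-- Induction along Pascal's rule. After removal of a coordinate the bound 2 (s + 1) ≤ n fails only
-- for n = 2 s + 1, where the two middle binomial coefficients agree and `spanning-middle` raises
-- the degree at no cost.
spanning : ∀ n s → s + s ≤ n → Spanning n s (n C s)
spanning n       zero    _ = spanning-constants n
spanning (suc n) (suc s) (s≤s h) = subst (Spanning (suc n) (suc s))
  (trans (+-comm (n C suc s) (n C s)) (nCk+nC[k+1]≡[n+1]C[k+1] n s))
  (spanning-step higher (spanning n s (≤-trans (n≤1+n _) 2s<n)))
  where
  2s<n : s + s < n
  2s<n = ≤-trans (≤-reflexive (sym (+-suc s s))) h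

  higher : Spanning n (suc s) (n C suc s)
  higher with suc s + suc s ≤? n
  ... | yes fits = spanning n (suc s) fits
  ... | no  ¬fits = subst (Spanning n (suc s)) symmetry
    (spanning-middle n≡ (spanning n s (≤-trans (n≤1+n _) 2s<n)))
    where
    n≡ : n ≡ suc (s + s)
    n≡ = ≤-antisym (≤-pred (≤-trans (≰⇒> ¬fits) (≤-reflexive (cong suc (+-suc s s))))) 2s<n

    symmetry : n C s ≡ n C suc s
    symmetry = trans (nCk≡nC[n∸k] (≤-trans (m≤m+n s s) (≤-trans (n≤1+n _) 2s<n)))
      (cong (n C_) (trans (cong (_∸ s) n≡) (m+n∸n≡m (suc s) s)))

-- The rank of the identity matrix

bit : Bool → Fin 2
bit false = zero
bit true  = suc zero

bit-injective : ∀ b c → bit b ≡ bit c → b ≡ c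
bit-injective false false _ = refl
bit-injective true  true  _ = refl

bits : Vec Bool n → Fin (2 ^ n)
bits []              = zero
bits {suc n} (b ∷ v) = combine {2} {2 ^ n} (bit b) (bits v)

bits-injective : ∀ (v w : Vec Bool n) → bits v ≡ bits w → v ≡ w
bits-injective []      []      _ = refl
bits-injective {suc n} (b ∷ v) (c ∷ w) e =
  let b≡c , v≡w = combine-injective {2} {2 ^ n} (bit b) (bits v) (bit c) (bits w) e
  in cong₂ _∷_ (bit-injective b c b≡c) (bits-injective v w v≡w)

bits-surjective : ∀ n i → ∃ λ (v : Vec Bool n) → bits v ≡ i
bits-surjective zero    zero = [] , refl
bits-surjective (suc n) i with combine-surjective {2} {2 ^ n} i
... | zero     , j , refl = let v , e = bits-surjective n j in
  false ∷ v , cong (combine {2} {2 ^ n} zero) e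
... | suc zero , j , refl = let v , e = bits-surjective n j in
  true ∷ v , cong (combine {2} {2 ^ n} (suc zero)) e

-- Dimensions are compared by counting points: an injection gives 2 ^ m ≤ 2 ^ n.
bitVector-injection⇒≤ : ∀ {m n} (f : Vec Bool m → Vec Bool n) → (∀ v w → f v ≡ f w → v ≡ w) → m ≤ n
bitVector-injection⇒≤ {m} {n} f inj with m ≤? n
... | yes m≤n = m≤n
... | no  m≰n = ⊥-elim (<⇒≱ (^-monoʳ-< 2 (s≤s (s≤s z≤n)) (≰⇒> m≰n)) (injective⇒≤ {f = g} g-injective))
  where
  g : Fin (2 ^ m) → Fin (2 ^ n)
  g = bits ∘ f ∘ proj₁ ∘ bits-surjective m

  g-injective : ∀ {i j} → g i ≡ g j → i ≡ j
  g-injective {i} {j} e = trans (sym (proj₂ (bits-surjective m i)))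
    (trans (cong bits (inj _ _ (bits-injective _ _ e))) (proj₂ (bits-surjective m j)))

combination : Vec Bool m → (Fin m → Vec Bool r) → Vec Bool r
combination []      B = replicate _ false
combination (b ∷ v) B = zipWith _xor_ (map (b ∧_) (B zero)) (combination v (B ∘ suc))

dot-combination : ∀ z b (v : Vec Bool m) (B : Fin (suc m) → Vec Bool r) →
  dot z (combination (b ∷ v) B) ≡ (b ∧ dot z (B zero)) xor dot z (combination v (B ∘ suc))
dot-combination z b v B = trans (dot-xorʳ z _ _) (cong (_xor _) (dot-∧ʳ b z (B zero)))

dot-combination-zero : ∀ z (v : Vec Bool m) (B : Fin m → Vec Bool r) →
  (∀ j → dot z (B j) ≡ false) → dot z (combination v B) ≡ false
dot-combination-zero z []      B h = dot-zeroʳ z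
dot-combination-zero z (b ∷ v) B h = trans (dot-combination z b v B)
  (cong₂ _xor_ (trans (cong (b ∧_) (h zero)) (∧-zeroʳ b)) (dot-combination-zero z v (B ∘ suc) (h ∘ suc)))

dot-combination-lookup : ∀ z (v : Vec Bool m) (B : Fin m → Vec Bool r) i →
  dot z (B i) ≡ true → (∀ j → i ≢ j → dot z (B j) ≡ false) → dot z (combination v B) ≡ lookup v i
dot-combination-lookup z (b ∷ v) B zero    h o = trans (dot-combination z b v B)
  (trans (cong₂ _xor_ (trans (cong (b ∧_) h) (∧-identityʳ b))
    (dot-combination-zero z v (B ∘ suc) (λ j → o (suc j) λ ()))) (xor-identityʳ b))
dot-combination-lookup z (b ∷ v) B (suc i) h o = trans (dot-combination z b v B)
  (cong₂ _xor_ (trans (cong (b ∧_) (o zero λ ())) (∧-zeroʳ b))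
    (dot-combination-lookup z v (B ∘ suc) i h (λ j i≢j → o (suc j) (i≢j ∘ Fin-suc-injective))))

-- v ↦ Σ vⱼ Bⱼ is injective on 𝔽₂^m, since pairing with Aᵢ recovers vᵢ.
identity-rank : (A B : Fin m → Vec Bool r) → (∀ i → dot (A i) (B i) ≡ true) →
  (∀ i j → i ≢ j → dot (A i) (B j) ≡ false) → m ≤ r
identity-rank A B diag off = bitVector-injection⇒≤ (λ v → combination v B) λ v w e →
  trans (sym (tabulate∘lookup v)) (trans (tabulate-cong λ i →
    trans (sym (recover v i)) (trans (cong (dot (A i)) e) (recover w i))) (tabulate∘lookup w))
  where
  recover : ∀ v i → dot (A i) (combination v B) ≡ lookup v i
  recover v i = dot-combination-lookup (A i) v B i (diag i) (off i)

-- Lowering degrees by means of traces that are missed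

matches : Subset n → Subset n → Subset n → Bool
matches []          []      []      = true
matches (false ∷ M) (_ ∷ S) (_ ∷ x) = matches M S x
matches (true ∷ M)  (s ∷ S) (b ∷ x) = not (s xor b) ∧ matches M S x

matches-sound : ∀ (M S x : Subset n) → matches M S x ≡ true → x ∩ M ≡ S ∩ M
matches-sound []          []          []          _ = refl
matches-sound (false ∷ M) (s ∷ S)     (b ∷ x)     e =
  cong₂ _∷_ (trans (∧-zeroʳ b) (sym (∧-zeroʳ s))) (matches-sound M S x e)
matches-sound (true ∷ M)  (false ∷ S) (false ∷ x) e = cong (false ∷_) (matches-sound M S x e)
matches-sound (true ∷ M)  (true ∷ S)  (true ∷ x)  e = cong (true ∷_) (matches-sound M S x e)

-- The indicator is a product over `M` of linear factors x_i + (1 + s_i), so its top term is x^M.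
matches-leading : ∀ (M S : Subset n) → Poly< ∣ M ∣ (λ x → monomial M x xor matches M S x)
matches-leading []          []      = ext 0# λ { [] → refl }
matches-leading (false ∷ M) (s ∷ S) = ext (poly-tail (matches-leading M S)) λ { (b ∷ x) → refl }
matches-leading (true ∷ M)  (s ∷ S) = ext
  (poly-head∧ (matches-leading M S) ⊕
    -- The summand `not s ∧ matches M S x` is obtained as a sum of two terms, x^M and x^M +
    -- `matches M S x`, whose degrees are known.
    (scale (not s) (gen (mono (false ∷ M) ≤-refl))
      ⊕ scale (not s) (poly-weaken (n≤1+n _) (poly-tail (matches-leading M S)))))
  λ { (b ∷ x) → expand s b (monomial M x) (matches M S x) }
  where
  expand : ∀ s b m k → (b ∧ (m xor k)) xor ((not s ∧ m) xor (not s ∧ (m xor k))) ≡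
    (b ∧ m) xor (not (s xor b) ∧ k)
  expand true  false m     k     = refl
  expand true  true  m     k     = xor-identityʳ _
  expand false false false k     = refl
  expand false false true  false = refl
  expand false false true  true  = refl
  expand false true  m     k     =
    solve 2 (λ m k → (m :+ k) :+ (m :+ (m :+ k)) := m :+ con false) refl m k

module _ {n d : ℕ} {𝓕 : List (Subset n)} (vd : VdimΔ≤ 𝓕 𝓕 d) where

  -- Comparing with `S ∩ M` lets `S` range over all subsets, ready for exhaustive search.
  Hit : Subset n → Subset n → Set
  Hit M S = Any (λ A → Any (λ B → (A Δ B) ∩ M ≡ S ∩ M) 𝓕) 𝓕

  hit? : ∀ M S → Dec (Hit M S)
  hit? M S = any? (λ A → any? (λ B → ≡-dec _≟ᵇ_ ((A Δ B) ∩ M) (S ∩ M)) 𝓕) 𝓕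

  -- `Hit M` is decidable and there are finitely many `S`, so a search yields a missed trace; if it
  -- found none, `M` would be shattered.
  missed-trace : ∀ M → d < ∣ M ∣ → ∃ λ S → ¬ Hit M S
  missed-trace M large with anySubset? (λ S → ¬? (hit? M S))
  ... | yes missed = missed
  ... | no  none   = ⊥-elim (<⇒≱ large (vd M shattered))
    where
    shattered : ShattersΔ 𝓕 𝓕 M
    shattered S S⊆M with find (decidable-stable (hit? M S) λ miss → none (S , miss))
    ... | A , A∈ , hits with find hits
    ... | B , B∈ , e = A Δ B , (A , B , A∈ , B∈ , refl) ,
      trans e (⊆-antisym (p∩q⊆p S M) λ x∈S → x∈p∩q⁺ (x∈S , S⊆M x∈S))

  AgreesΔ : BoolFun (Subset n) → BoolFun (Subset n) → Set
  AgreesΔ f g = ∀ A B → A ∈ 𝓕 → B ∈ 𝓕 → f (A Δ B) ≡ g (A Δ B)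

  -- If no member of 𝓕 Δ 𝓕 has trace S on M, the indicator of that trace vanishes there, and its
  -- leading monomial is that of M.
  lower-degree : ∀ k {f} → Poly< (suc (k + d)) f → ∃ λ g → Poly< (suc d) g × AgreesΔ f g
  lower-degree zero    p = _ , p , λ _ _ _ _ → refl
  lower-degree (suc k) p with span-fold Lowers
      (_ , 0# , λ _ _ _ _ → refl)
      (λ (g , p , e) (h , q , e′) → _ , p ⊕ q , λ A B A∈ B∈ → cong₂ _xor_ (e A B A∈ B∈) (e′ A B A∈ B∈))
      (λ (g , p , e) h → g , p , λ A B A∈ B∈ → trans (sym (h _)) (e A B A∈ B∈))
      (λ { (mono M l) → lowers M l }) p
    where
    Lowers : BoolFun (Subset n) → Set
    Lowers f = ∃ λ g → Poly< (suc (k + d)) g × AgreesΔ f g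

    lowers : ∀ M → ∣ M ∣ < suc (suc (k + d)) → Lowers (monomial M)
    lowers M l with ∣ M ∣ ≤? k + d
    ... | yes small = _ , gen (mono M (s≤s small)) , λ _ _ _ _ → refl
    ... | no  large with missed-trace M (≤-trans (s≤s (m≤n+m d k)) (≰⇒> large))
    ... | S , missed = _ , poly-weaken (≤-pred l) (matches-leading M S) , λ A B A∈ B∈ →
      sym (trans (cong (monomial M (A Δ B) xor_) (vanishes A B A∈ B∈)) (xor-identityʳ _))
      where
      vanishes : ∀ A B → A ∈ 𝓕 → B ∈ 𝓕 → matches M S (A Δ B) ≡ false
      vanishes A B A∈ B∈ = ¬-not λ e →
        missed (lose A∈ (lose B∈ (matches-sound M S (A Δ B) e)))
  ... | g , p′ , e with lower-degree k p′
  ... | h , p″ , e′ = h , p″ , λ A B A∈ B∈ → trans (e A B A∈ B∈) (e′ A B A∈ B∈)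

-- Expanding P(x + y), and the indicator of ∅

data BiMonomial< (t : ℕ) : BoolFun (Subset n × Subset n) → Set where
  bimono : (I J : Subset n) → ∣ I ∣ + ∣ J ∣ < t →
    BiMonomial< t (λ xy → monomial I (proj₁ xy) ∧ monomial J (proj₂ xy))

-- The coordinates of x Δ y are sums x_i + y_i. Expanding their product over M distributes M between
-- x and y, so the total degree does not grow.
poly-Δ : ∀ {f : BoolFun (Subset n)} → Poly< t f →
  Span (BiMonomial< t) (λ xy → f (proj₁ xy Δ proj₂ xy))
poly-Δ = span-pullback (λ xy → proj₁ xy Δ proj₂ xy) λ
  { (mono M l) → span-mono (λ { (bimono I J p) → bimono I J (≤-trans p l) }) (monomial-Δ M) }
  where
  tails : Subset (suc m) × Subset (suc m) → Subset m × Subset m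
  tails (x , y) = tail x , tail y

  monomial-Δ : ∀ {n} (M : Subset n) →
    Span (BiMonomial< (suc ∣ M ∣)) (λ xy → monomial M (proj₁ xy Δ proj₂ xy))
  monomial-Δ []          = gen (bimono [] [] z<s)
  monomial-Δ (false ∷ M) = ext
    (span-pullback tails (λ { (bimono I J p) → gen (bimono (false ∷ I) (false ∷ J) p) }) (monomial-Δ M))
    λ { (b ∷ x , c ∷ y) → refl }
  monomial-Δ (true ∷ M)  = ext
    (span-weighted-pullback (head ∘ proj₁) tails
      (λ { (bimono I J p) → ext (gen (bimono (true ∷ I) (false ∷ J) (s≤s p)))
             λ xy → ∧-assoc (head (proj₁ xy)) _ _ }) (monomial-Δ M)
    ⊕ span-weighted-pullback (head ∘ proj₂) tails
      (λ { (bimono I J p) → ext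
             (gen (bimono (false ∷ I) (true ∷ J) (≤-trans (≤-reflexive (cong suc (+-suc _ _))) (s≤s p))))
             λ xy → solve 3 (λ a b c → a :* (b :* c) := b :* (a :* c)) refl
               (monomial I (tail (proj₁ xy))) (head (proj₂ xy)) (monomial J (tail (proj₂ xy))) }) (monomial-Δ M))
    λ { (b ∷ x , c ∷ y) → sym (∧-distribʳ-xor (monomial M (x Δ y)) b c) }

-- This is the product of all 1 + x_i, of degree `n`.
isEmpty : Subset n → Bool
isEmpty x = monomial ⊤ (∁ x)

isEmpty-poly : Poly< {n} (suc n) isEmpty
isEmpty-poly {n} = poly-∁ (gen (mono ⊤ (s≤s (∣p∣≤n ⊤))))

isEmpty-self : ∀ (x : Subset n) → isEmpty (x Δ x) ≡ true
isEmpty-self []      = refl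
isEmpty-self (b ∷ x) rewrite xor-same b = isEmpty-self x

isEmpty-Δ : ∀ (x y : Subset n) → isEmpty (x Δ y) ≡ true → x ≡ y
isEmpty-Δ []          []          _ = refl
isEmpty-Δ (false ∷ x) (false ∷ y) e = cong (false ∷_) (isEmpty-Δ x y e)
isEmpty-Δ (true ∷ x)  (true ∷ y)  e = cong (true ∷_) (isEmpty-Δ x y e)

-- The Croot-Lev-Pach factorisation on a slice

module _ {a : Subset n → Vec Bool r} {s ℓ : ℕ}
  (red : ∀ {f} → Poly< (suc s) f → Reducible a ℓ (suc s) (f ∘ proj₂)) where

  on-level : ∀ {f} → Poly< (suc s) f → ∃ λ c → ∀ x → ∣ ∁ x ∣ ≡ ℓ → f x ≡ dot c (a x)
  on-level p with red p
  ... | c , q , pq , e = c , λ x d → trans (e zero x d)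
    (trans (cong (dot c (a x) xor_) (slackSpan-vanishes pq x)) (xor-identityʳ _))

  -- A factorisation of rank at most 2r: on the slice, K is the inner product of (`a x`, `β x`) with
  -- (`α y`, `a y`).
  Factored : BoolFun (Subset n × Subset n) → Set
  Factored K = Σ (Subset n → Vec Bool r) λ α → Σ (Subset n → Vec Bool r) λ β → ∀ x y → ∣ ∁ x ∣ ≡ ℓ → ∣ ∁ y ∣ ≡ ℓ →
    K (x , y) ≡ dot (a x) (α y) xor dot (β x) (a y)

  -- Total degree at most 2 s + 1 forces one of the two monomials to have degree at most `s`. That
  -- one is expanded in `a`; the other is absorbed into the coefficients `α` or `β`.
  factored : ∀ {t K} → t ≤ suc (suc (s + s)) → Span (BiMonomial< t) K → Factored K
  factored {t} t≤ = span-fold Factored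
    ((λ _ → replicate _ false) , (λ _ → replicate _ false) , λ x y _ _ →
      sym (cong₂ _xor_ (dot-zeroʳ (a x)) (dot-zeroˡ (a y))))
    (λ (α , β , e) (α′ , β′ , e′) →
      (λ y → zipWith _xor_ (α y) (α′ y)) , (λ x → zipWith _xor_ (β x) (β′ x)) , λ x y dx dy →
        trans (cong₂ _xor_ (e x y dx dy) (e′ x y dx dy))
          (trans (interchange (dot (a x) (α y)) _ _ _)
            (sym (cong₂ _xor_ (dot-xorʳ (a x) (α y) (α′ y)) (dot-xorˡ (β x) (β′ x) (a y))))))
    (λ (α , β , e) h → α , β , λ x y dx dy → trans (sym (h (x , y))) (e x y dx dy))
    λ { (bimono I J p) → split I J p }
    where
    split : ∀ I J → ∣ I ∣ + ∣ J ∣ < t → Factored (λ xy → monomial I (proj₁ xy) ∧ monomial J (proj₂ xy))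
    split I J p with ∣ I ∣ ≤? s
    ... | yes small with on-level (gen (mono I (s≤s small)))
    ... | c , e = (λ y → map (monomial J y ∧_) c) , (λ _ → replicate _ false) , λ x y dx _ →
      trans (cong (_∧ monomial J y) (e x dx)) (trans (∧-comm _ (monomial J y))
        (trans (cong (monomial J y ∧_) (dot-comm c (a x))) (trans (sym (dot-∧ʳ (monomial J y) (a x) c))
          (sym (trans (cong (dot (a x) (map (monomial J y ∧_) c) xor_) (dot-zeroˡ (a y))) (xor-identityʳ _))))))
    split I J p | no large with on-level (gen (mono J (+-cancelˡ-< (suc s) ∣ J ∣ (suc s) J-small)))
      where
      J-small : suc s + ∣ J ∣ < suc s + suc s
      J-small = ≤-trans (s≤s (+-monoˡ-≤ ∣ J ∣ (≰⇒> large)))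
        (≤-trans p (≤-trans t≤ (≤-reflexive (cong suc (sym (+-suc s s))))))
    ... | c , e = (λ _ → replicate _ false) , (λ x → map (monomial I x ∧_) c) , λ x y _ dy →
      trans (cong (monomial I x ∧_) (e y dy)) (trans (sym (dot-∧ˡ (monomial I x) c (a y)))
        (cong (_xor dot (map (monomial I x ∧_) c) (a y)) (sym (dot-zeroʳ (a x)))))

-- The bound on the family

unique-lookup-injective : ∀ {xs : List X} → Unique xs → ∀ i j → List.lookup xs i ≡ List.lookup xs j → i ≡ j
unique-lookup-injective (_ ∷ _)  zero    zero    _ = refl
unique-lookup-injective (x∉ ∷ _) zero    (suc j) e = ⊥-elim (All.lookup x∉ (∈-lookup j) e)
unique-lookup-injective (x∉ ∷ _) (suc i) zero    e = ⊥-elim (All.lookup x∉ (∈-lookup i) (sym e))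
unique-lookup-injective (_ ∷ u)  (suc i) (suc j) e = cong suc (unique-lookup-injective u i j e)

isEmpty-lower-degree : ∀ {n d} {𝓕 : List (Subset n)} (vd : VdimΔ≤ 𝓕 𝓕 d) → d ≤ n →
  ∃ λ g → Poly< (suc d) g × AgreesΔ vd isEmpty g
isEmpty-lower-degree {n} {d} vd d≤n =
  lower-degree vd (n ∸ d) (poly-weaken (s≤s (≤-reflexive (sym (m∸n+n≡m d≤n)))) isEmpty-poly)

length≤2r : ∀ {n d k s r} {𝓕 : List (Subset n)} → Spanning n s r → d ≤ n → d ≤ suc (s + s) → Unique 𝓕 →
  (∀ F → F ∈ 𝓕 → ∣ F ∣ ≡ k) → VdimΔ≤ 𝓕 𝓕 d → length 𝓕 ≤ r + r
length≤2r {n} {d} {k} {s} {r} {𝓕} (a , red) d≤n d≤2s+1 unique uniform vd =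
  bound (isEmpty-lower-degree vd d≤n)
  where
  F : Fin (length 𝓕) → Subset n
  F = List.lookup 𝓕

  -- Uniformity enters here: all members lie on one slice, where a single reduction applies.
  level : ∀ i → ∣ ∁ (F i) ∣ ≡ n ∸ k
  level i = trans (∣∁p∣≡n∸∣p∣ (F i)) (cong (n ∸_) (uniform (F i) (∈-lookup i)))

  bound : (∃ λ g → Poly< (suc d) g × AgreesΔ vd isEmpty g) → length 𝓕 ≤ r + r
  bound (g , p , agrees) = rank (factored {a = a} (red (n ∸ k)) (s≤s d≤2s+1) (poly-Δ p))
    where
    rank : Factored {a = a} (red (n ∸ k)) (λ xy → g (proj₁ xy Δ proj₂ xy)) → length 𝓕 ≤ r + r
    -- Concatenation merges the two inner products of `Factored` into one of length `r + r`.
    rank (α , β , e) = identity-rank (λ i → a (F i) ++ β (F i)) (λ j → α (F j) ++ a (F j))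
      (λ i → trans (matrix i i) (isEmpty-self (F i)))
      (λ i j i≢j → trans (matrix i j)
        (¬-not λ h → i≢j (unique-lookup-injective unique i j (isEmpty-Δ (F i) (F j) h))))
      where
      matrix : ∀ i j → dot (a (F i) ++ β (F i)) (α (F j) ++ a (F j)) ≡ isEmpty (F i Δ F j)
      matrix i j = trans (dot-++ (a (F i)) (α (F j)) (β (F i)) (a (F j)))
        (sym (trans (agrees (F i) (F j) (∈-lookup i) (∈-lookup j)) (e (F i) (F j) (level i) (level j))))

theorem1p5 : (n d : ℕ) → d ≤ n → (𝓕 : List (Subset n)) → Unique 𝓕 →
    Uniform 𝓕 → VdimΔ≤ 𝓕 𝓕 d → length 𝓕 ≤ 2 * (n C (d / 2))
theorem1p5 n d d≤n 𝓕 unique (k , uniform) vd =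
  subst (length 𝓕 ≤_) (cong (n C (d / 2) +_) (sym (+-identityʳ (n C (d / 2)))))
    (length≤2r {s = d / 2} {n C (d / 2)} (spanning n (d / 2) half≤) d≤n d≤2s+1 unique uniform vd)
  where
  double : d / 2 * 2 ≡ d / 2 + d / 2
  double = trans (*-comm (d / 2) 2) (cong (d / 2 +_) (+-identityʳ _))

  half≤ : d / 2 + d / 2 ≤ n
  half≤ = ≤-trans (≤-trans (≤-reflexive (sym double)) (m/n*n≤m d 2)) d≤n

  -- The factorisation tolerates degree 2 s + 1, so s = ⌊d/2⌋ also serves odd `d`.
  d≤2s+1 : d ≤ suc (d / 2 + d / 2)
  d≤2s+1 = begin
    d                     ≡⟨ m≡m%n+[m/n]*n d 2 ⟩
    d % 2 + d / 2 * 2     ≤⟨ +-monoˡ-≤ (d / 2 * 2) (≤-pred (m%n<n d 2)) ⟩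
    suc (d / 2 * 2)       ≡⟨ cong suc double ⟩
    suc (d / 2 + d / 2)   ∎
    where open ≤-Reasoning
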